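{- Let $t$ be a closed $\lambda$-term. If there is a derivation $\pi\triangleright\ \vdash^{(m,e)} t : L$ (with empty type context) in the silly multi type system, then there are an abstraction $v$ and a reduction sequence $d: t\to_{\beta_v}^* v$ with $|d|\leq m$.
   Context: $\lambda$-terms $t ::= x\mid\lambda x.t\mid tu$; values are abstractions. CbV contexts $V ::= \langle\cdot\rangle\mid tV\mid Vt$; root rule $(\lambda x.t)v\mapsto_{\beta_v} t\{x:=v\}$ for $v$ a value (capture-avoiding meta-level substitution); $\to_{\beta_v}$ is its closure under CbV contexts; $|d|$ is the length of $d$. Silly multi types: linear types $L ::= \mathtt{n} \mid M\multimap L$; multi types $M ::= [L_i]_{i\in I}$ finite multisets ($\mathbf{0}$ empty, $\uplus$ sum). Type contexts $\Gamma$ map variables to multi types with finite support; $\uplus$ pointwise; $\Gamma\setminus\!\!\setminus x$ sets $x$ to $\mathbf{0}$. Rules: (ax) $x:[L]\vdash^{(0,1)} x:L$; (many) from $(\Gamma_i\vdash^{(m_i,e_i)} t : L_i)_{i\in I}$, $I$ finite possibly empty, infer $\uplus_i\Gamma_i\vdash^{(\sum m_i,\sum e_i)} t : [L_i]_{i\in I}$; ($\mathrm{ax}_\lambda$) $\vdash^{(0,0)}\lambda x.t:\mathtt{n}$; ($\lambda$) from $\Gamma\vdash^{(m,e)}t:L$ infer $\Gamma\setminus\!\!\setminus x\vdash^{(m,e)}\lambda x.t:\Gamma(x)\multimap L$; (@) from $\Gamma\vdash^{(m,e)} t : M\multimap L$ and $\Delta\vdash^{(m',e')} u : M\uplus[\mathtt{n}]$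 infer $\Gamma\uplus\Delta\vdash^{(m+m'+1,e+e')} tu : L$. (There is also a rule for explicit substitutions, irrelevant for $\lambda$-terms.) -}

module Defs where

open import Data.Fin.Base using (Fin; zero; suc)
open import Data.List.Base using (List; []; _∷_; _++_; [_])
open import Data.List.Relation.Binary.Permutation.Homogeneous using (Permutation)
open import Data.Nat.Base using (ℕ; zero; suc; _+_)
open import Data.Vec.Base using (Vec; _∷_; replicate; zipWith; _[_]≔_)
open import Data.Vec.Functional using (Vector; foldr; toList)
open import Data.Vec.Relation.Binary.Pointwise.Inductive using (Pointwise)
open import Relation.Binary.Construct.Closure.ReflexiveTransitive using (Star; ε; _◅_)

infixl 7 _·_
infixr 6 _⊸_
infixr 5 _⊎_
infix  4 _≈_ _≈ᴹ_ _≈ᶜ_ _↦βv_ _→βv_ _→βv*_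
infix  3 _⊢⟨_,_⟩_∶_ _⊢⟨_,_⟩_∶ᴹ_

-- λ-terms up to α-equivalence, as well-scoped de Bruijn terms:
-- Term n has its free variables among n, and closed terms are Term 0.

data Term (n : ℕ) : Set where
  var : Fin n → Term n
  ƛ   : Term (suc n) → Term n
  _·_ : Term n → Term n → Term n

data Value {n : ℕ} : Term n → Set where
  ƛ : (t : Term (suc n)) → Value (ƛ t)

extᴿ : ∀ {n k} → (Fin n → Fin k) → Fin (suc n) → Fin (suc k)
extᴿ ρ zero    = zero
extᴿ ρ (suc x) = suc (ρ x)

rename : ∀ {n k} → (Fin n → Fin k) → Term n → Term k
rename ρ (var x) = var (ρ x)
rename ρ (ƛ t)   = ƛ (rename (extᴿ ρ) t)
rename ρ (t · u) = rename ρ t · rename ρ u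

extˢ : ∀ {n k} → (Fin n → Term k) → Fin (suc n) → Term (suc k)
extˢ σ zero    = var zero
extˢ σ (suc x) = rename suc (σ x)

subst : ∀ {n k} → (Fin n → Term k) → Term n → Term k
subst σ (var x) = σ x
subst σ (ƛ t)   = ƛ (subst (extˢ σ) t)
subst σ (t · u) = subst σ t · subst σ u

single : ∀ {n} → Term n → Fin (suc n) → Term n
single u zero    = u
single u (suc x) = var x

_⟦_⟧ : ∀ {n} → Term (suc n) → Term n → Term n
t ⟦ u ⟧ = subst (single u) t

data CbVContext (n : ℕ) : Set where
  hole : CbVContext n
  appʳ : Term n → CbVContext n → CbVContext n
  appˡ : CbVContext n → Term n → CbVContext n

_⟨_⟩ : ∀ {n} → CbVContext n → Term n → Term n
hole     ⟨ t ⟩ = t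
appʳ u V ⟨ t ⟩ = u · (V ⟨ t ⟩)
appˡ V u ⟨ t ⟩ = (V ⟨ t ⟩) · u

data _↦βv_ {n : ℕ} : Term n → Term n → Set where
  βv : (t : Term (suc n)) {v : Term n} → Value v → ƛ t · v ↦βv t ⟦ v ⟧

data _→βv_ {n : ℕ} : Term n → Term n → Set where
  close : (V : CbVContext n) {t u : Term n} → t ↦βv u → V ⟨ t ⟩ →βv V ⟨ u ⟩

_→βv*_ : ∀ {n} → Term n → Term n → Set
_→βv*_ = Star _→βv_

∣_∣ : ∀ {n} {t u : Term n} → t →βv* u → ℕ
∣ ε ∣     = 0
∣ _ ◅ d ∣ = suc ∣ d ∣

-- Multisets are represented by lists. Their equality is _≈ᴹ_, permutation up
-- to _≈_, where _≈_ in turn identifies linear types hereditarily.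

data Linear : Set where
  𝗇   : Linear
  _⊸_ : List Linear → Linear → Linear

Multi : Set
Multi = List Linear

data _≈_ : Linear → Linear → Set where
  𝗇   : 𝗇 ≈ 𝗇
  _⊸_ : ∀ {M M′ L L′} → Permutation _≈_ M M′ → L ≈ L′ → M ⊸ L ≈ M′ ⊸ L′

_≈ᴹ_ : Multi → Multi → Set
_≈ᴹ_ = Permutation _≈_

-- A type context for terms in Term n gives a multi type to each of the n
-- variables; all other variables implicitly have the empty multi type.

TypeContext : ℕ → Set
TypeContext n = Vec Multi n

_≈ᶜ_ : ∀ {n} → TypeContext n → TypeContext n → Set
_≈ᶜ_ = Pointwise _≈ᴹ_

∅ : ∀ {n} → TypeContext n
∅ {n} = replicate n []

_⊎_ : ∀ {n} → TypeContext n → TypeContext n → TypeContext n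
_⊎_ = zipWith _++_

sum : ∀ {k} → Vector ℕ k → ℕ
sum = foldr _+_ 0

⨄ : ∀ {n k} → Vector (TypeContext n) k → TypeContext n
⨄ = foldr _⊎_ ∅

-- The rules conv and convᴹ only make judgements invariant under the choice of
-- lists representing multisets; they leave the indices (m , e) unchanged.
-- In the rule lam, M is Γ(x) and the context of the conclusion is Γ \\ x.

mutual
  data _⊢⟨_,_⟩_∶_ {n : ℕ} : TypeContext n → ℕ → ℕ → Term n → Linear → Set where
    ax   : ∀ {x L} → ∅ [ x ]≔ [ L ] ⊢⟨ 0 , 1 ⟩ var x ∶ L
    axƛ  : ∀ {t} → ∅ ⊢⟨ 0 , 0 ⟩ ƛ t ∶ 𝗇
    lam  : ∀ {Γ M m e t L} →
           M ∷ Γ ⊢⟨ m , e ⟩ t ∶ L →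
           Γ ⊢⟨ m , e ⟩ ƛ t ∶ M ⊸ L
    app  : ∀ {Γ Δ M m e m′ e′ t u L} →
           Γ ⊢⟨ m , e ⟩ t ∶ M ⊸ L →
           Δ ⊢⟨ m′ , e′ ⟩ u ∶ᴹ M ++ [ 𝗇 ] →
           Γ ⊎ Δ ⊢⟨ m + m′ + 1 , e + e′ ⟩ t · u ∶ L
    conv : ∀ {Γ Γ′ m e t L L′} →
           Γ ≈ᶜ Γ′ → L ≈ L′ →
           Γ ⊢⟨ m , e ⟩ t ∶ L →
           Γ′ ⊢⟨ m , e ⟩ t ∶ L′

  data _⊢⟨_,_⟩_∶ᴹ_ {n : ℕ} : TypeContext n → ℕ → ℕ → Term n → Multi → Set where
    many  : ∀ {k t} {Γ : Vector (TypeContext n) k} {m e : Vector ℕ k} {L : Vector Linear k} →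
            (∀ i → Γ i ⊢⟨ m i , e i ⟩ t ∶ L i) →
            ⨄ Γ ⊢⟨ sum m , sum e ⟩ t ∶ᴹ toList L
    convᴹ : ∀ {Γ Γ′ m e t M M′} →
            Γ ≈ᶜ Γ′ → M ≈ᴹ M′ →
            Γ ⊢⟨ m , e ⟩ t ∶ᴹ M →
            Γ′ ⊢⟨ m , e ⟩ t ∶ᴹ M′

{-# OPTIONS --safe #-}

-- The proof is a quantitative realizability argument. Each linear type L is
-- interpreted as a predicate V L v k on closed values v and budgets k, and a
-- computation realizes L with budget k when it evaluates to a value that
-- realizes L with what is left of k after paying one unit per β-step. Budgets
-- are shared among the elements of a multiset by a separating conjunction.
-- The copies of an argument typed by M ⊎ [𝗇] all evaluate to the same value
-- because evaluation is deterministic; one copy, present thanks to 𝗇, pays for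
-- the actual evaluation of the argument.

module Submission where

open import Defs
open import Data.Fin.Base using (Fin; zero; suc)
open import Data.List.Base using ([]; _∷_; _++_; [_])
open import Data.List.Properties using (++-conicalʳ)
open import Data.List.Relation.Binary.Permutation.Homogeneous using (refl; prep; swap; trans)
open import Data.List.Relation.Binary.Pointwise.Base as Listwise using ([]; _∷_)
open import Data.Nat.Base using (ℕ; zero; suc; _+_; _≤_; z≤n)
open import Data.Nat.Properties using (≤-refl; ≤-reflexive; ≤-trans; +-mono-≤; +-monoʳ-≤; +-assoc; +-identityʳ; m≤m+n; m≤n+m; m+n≤o⇒m≤o; m+n≤o⇒n≤o; module ≤-Reasoning)
open import Data.Nat.Tactic.RingSolver using (solve-∀)
open import Data.Product.Base using (Σ-syntax; ∃-syntax; _×_; _,_)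
open import Data.Sum.Base using (inj₁; inj₂) renaming (_⊎_ to _or_)
open import Data.Unit.Base using (⊤; tt)
open import Data.Vec.Base using ([]; _∷_; _[_]≔_)
open import Data.Vec.Functional using (Vector; toList; tail) renaming (_∷_ to _∷ᶠ_)
open import Data.Vec.Relation.Binary.Pointwise.Inductive using ([]; _∷_)
open import Function.Base using (_∘_; id)
open import Relation.Binary.Construct.Closure.ReflexiveTransitive using (ε; _◅_)
open import Relation.Binary.PropositionalEquality using (_≡_; _≗_; refl; sym; cong; cong₂) renaming (trans to ≡-trans; subst to transport)

-- Substitution

-- The fusion laws take the composite as a separate map with a pointwise equation: under a binder it
-- suffices to extend that equation, with no appeal to function extensionality.
rename-rename : ∀ {i j k} {ρ : Fin i → Fin j} {ρ′ : Fin j → Fin k} {ρ″ : Fin i → Fin k} →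
                ρ′ ∘ ρ ≗ ρ″ → rename ρ′ ∘ rename ρ ≗ rename ρ″
rename-rename eq (var x) = cong var (eq x)
rename-rename eq (ƛ t)   = cong ƛ (rename-rename (λ { zero → refl ; (suc x) → cong suc (eq x) }) t)
rename-rename eq (t · u) = cong₂ _·_ (rename-rename eq t) (rename-rename eq u)

subst-rename : ∀ {i j k} {ρ : Fin i → Fin j} {σ : Fin j → Term k} {τ : Fin i → Term k} →
               σ ∘ ρ ≗ τ → subst σ ∘ rename ρ ≗ subst τ
subst-rename eq (var x) = eq x
subst-rename eq (ƛ t)   = cong ƛ (subst-rename (λ { zero → refl ; (suc x) → cong (rename suc) (eq x) }) t)
subst-rename eq (t · u) = cong₂ _·_ (subst-rename eq t) (subst-rename eq u)

rename-suc-extᴿ : ∀ {j k} (ρ : Fin j → Fin k) → rename (extᴿ ρ) ∘ rename suc ≗ rename suc ∘ rename ρ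
rename-suc-extᴿ ρ t = ≡-trans (rename-rename (λ _ → refl) t) (sym (rename-rename (λ _ → refl) t))

rename-subst : ∀ {i j k} {σ : Fin i → Term j} {ρ : Fin j → Fin k} {τ : Fin i → Term k} →
               rename ρ ∘ σ ≗ τ → rename ρ ∘ subst σ ≗ subst τ
rename-subst eq (var x) = eq x
rename-subst {σ = σ} {ρ} eq (ƛ t) = cong ƛ (rename-subst
  (λ { zero → refl ; (suc x) → ≡-trans (rename-suc-extᴿ ρ (σ x)) (cong (rename suc) (eq x)) }) t)
rename-subst eq (t · u) = cong₂ _·_ (rename-subst eq t) (rename-subst eq u)

subst-suc-extˢ : ∀ {j k} (τ : Fin j → Term k) → subst (extˢ τ) ∘ rename suc ≗ rename suc ∘ subst τ
subst-suc-extˢ τ t = ≡-trans (subst-rename (λ _ → refl) t) (sym (rename-subst (λ _ → refl) t))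

subst-subst : ∀ {i j k} {σ : Fin i → Term j} {τ : Fin j → Term k} {υ : Fin i → Term k} →
              subst τ ∘ σ ≗ υ → subst τ ∘ subst σ ≗ subst υ
subst-subst eq (var x) = eq x
subst-subst {σ = σ} {τ} eq (ƛ t) = cong ƛ (subst-subst
  (λ { zero → refl ; (suc x) → ≡-trans (subst-suc-extˢ τ (σ x)) (cong (rename suc) (eq x)) }) t)
subst-subst eq (t · u) = cong₂ _·_ (subst-subst eq t) (subst-subst eq u)

subst-id : ∀ {n} {σ : Fin n → Term n} → σ ≗ var → subst σ ≗ id
subst-id eq (var x) = eq x
subst-id eq (ƛ t)   = cong ƛ (subst-id (λ { zero → refl ; (suc x) → cong (rename suc) (eq x) }) t)
subst-id eq (t · u) = cong₂ _·_ (subst-id eq t) (subst-id eq u)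

-- Lets the `lam` case of `adequacy` treat a β-contractum as the body run in an extended
-- environment.
subst-extˢ-⟦⟧ : ∀ {n k} (σ : Fin n → Term k) w t → subst (extˢ σ) t ⟦ w ⟧ ≡ subst (w ∷ᶠ σ) t
subst-extˢ-⟦⟧ σ w = subst-subst λ
  { zero    → refl
  ; (suc x) → ≡-trans (subst-rename (λ _ → refl) (σ x)) (subst-id (λ _ → refl) (σ x))
  }

-- Big-step evaluation, counting β-steps

infix 4 _⇓⟨_⟩_

data _⇓⟨_⟩_ {n : ℕ} : Term n → ℕ → Term n → Set where
  ƛ   : ∀ {t} → ƛ t ⇓⟨ 0 ⟩ ƛ t
  app : ∀ {t u b v w i j k} →
        t ⇓⟨ i ⟩ ƛ b → u ⇓⟨ j ⟩ v → b ⟦ v ⟧ ⇓⟨ k ⟩ w →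
        t · u ⇓⟨ i + (j + suc k) ⟩ w

⇓-value : ∀ {n} {t v : Term n} {k} → t ⇓⟨ k ⟩ v → Value v
⇓-value ƛ             = ƛ _
⇓-value (app _ _ b⇓w) = ⇓-value b⇓w

value-⇓ : ∀ {n} {v : Term n} → Value v → v ⇓⟨ 0 ⟩ v
value-⇓ (ƛ t) = ƛ

-- Each term shape has at most one evaluation rule, and equal results for both subterms give equal
-- contracta. Single steps `→βv` lack this: either side of an application may move first.
⇓-deterministic : ∀ {n} {t v v′ : Term n} {k k′} → t ⇓⟨ k ⟩ v → t ⇓⟨ k′ ⟩ v′ → v ≡ v′
⇓-deterministic ƛ ƛ = refl
⇓-deterministic (app t⇓ u⇓ b⇓) (app t⇓′ u⇓′ b⇓′)
  with refl ← ⇓-deterministic t⇓ t⇓′ | refl ← ⇓-deterministic u⇓ u⇓′ = ⇓-deterministic b⇓ b⇓′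

-- Reduction sequences of known length

infix 4 _→βv⟨_⟩_

_→βv⟨_⟩_ : ∀ {n} → Term n → ℕ → Term n → Set
t →βv⟨ k ⟩ u = Σ[ d ∈ t →βv* u ] ∣ d ∣ ≡ k

→βv⟨⟩-trans : ∀ {n} {t u v : Term n} {j k} → t →βv⟨ j ⟩ u → u →βv⟨ k ⟩ v → t →βv⟨ j + k ⟩ v
→βv⟨⟩-trans (ε , refl)     e          = e
→βv⟨⟩-trans (s ◅ d , refl) (d′ , eq) with →βv⟨⟩-trans (d , refl) (d′ , eq)
... | d″ , eq″ = s ◅ d″ , cong suc eq″

→βv⟨⟩-appˡ : ∀ {n} {t t′ u : Term n} {k} → t →βv⟨ k ⟩ t′ → t · u →βv⟨ k ⟩ t′ · u
→βv⟨⟩-appˡ (ε , eq) = ε , eq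
→βv⟨⟩-appˡ (close V r ◅ d , refl) with →βv⟨⟩-appˡ (d , refl)
... | d′ , eq = close (appˡ V _) r ◅ d′ , cong suc eq

→βv⟨⟩-appʳ : ∀ {n} {t u u′ : Term n} {k} → u →βv⟨ k ⟩ u′ → t · u →βv⟨ k ⟩ t · u′
→βv⟨⟩-appʳ (ε , eq) = ε , eq
→βv⟨⟩-appʳ (close V r ◅ d , refl) with →βv⟨⟩-appʳ (d , refl)
... | d′ , eq = close (appʳ _ V) r ◅ d′ , cong suc eq

⇓⇒→βv⟨⟩ : ∀ {n} {t v : Term n} {k} → t ⇓⟨ k ⟩ v → t →βv⟨ k ⟩ v
⇓⇒→βv⟨⟩ ƛ = ε , refl
⇓⇒→βv⟨⟩ (app {b = b} t⇓ u⇓ b⇓) with ⇓⇒→βv⟨⟩ b⇓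
... | d , eq = →βv⟨⟩-trans (→βv⟨⟩-appˡ (⇓⇒→βv⟨⟩ t⇓)) (→βv⟨⟩-trans (→βv⟨⟩-appʳ (⇓⇒→βv⟨⟩ u⇓))
                 (close hole (βv b (⇓-value u⇓)) ◅ d , cong suc eq))

-- Budgeted predicates

Budgeted : Set₁
Budgeted = ℕ → Set

infixr 6 _✶_
infix 4 _⊆_

_⊆_ : Budgeted → Budgeted → Set
P ⊆ Q = ∀ {k} → P k → Q k

-- With `≤` in place of equality a split may waste budget, so a product tolerates a larger budget
-- without monotonicity of its factors.
_✶_ : Budgeted → Budgeted → Budgeted
(P ✶ Q) k = ∃[ i ] ∃[ j ] (i + j ≤ k × P i × Q j)

✶-map : ∀ {P P′ Q Q′} → P ⊆ P′ → Q ⊆ Q′ → P ✶ Q ⊆ P′ ✶ Q′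
✶-map f g (i , j , le , p , q) = i , j , le , f p , g q

✶-assoc : ∀ {P Q R} → P ✶ (Q ✶ R) ⊆ (P ✶ Q) ✶ R
✶-assoc (i , _ , le , p , j , k , le′ , q , r) =
  i + j , k , ≤-trans (≤-reflexive (+-assoc i j k)) (≤-trans (+-monoʳ-≤ i le′) le) , (i , j , ≤-refl , p , q) , r

✶-interchange : ∀ {P Q R S} → (P ✶ Q) ✶ (R ✶ S) ⊆ (P ✶ R) ✶ (Q ✶ S)
✶-interchange (_ , _ , le , (a , b , le₁ , p , q) , (c , d , le₂ , r , s)) =
  a + c , b + d , ≤-trans (≤-reflexive (eq a b c d)) (≤-trans (+-mono-≤ le₁ le₂) le)
  , (a , c , ≤-refl , p , r) , (b , d , ≤-refl , q , s)
  where
  eq : ∀ a b c d → (a + c) + (b + d) ≡ (a + b) + (c + d)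
  eq = solve-∀

✶-swap : ∀ {P Q R} → P ✶ (Q ✶ R) ⊆ Q ✶ (P ✶ R)
✶-swap (a , _ , le , p , b , c , le′ , q , r) =
  b , a + c , ≤-trans (≤-reflexive (eq a b c)) (≤-trans (+-monoʳ-≤ a le′) le) , q , (a , c , ≤-refl , p , r)
  where
  eq : ∀ a b c → b + (a + c) ≡ a + (b + c)
  eq = solve-∀

Eval : (Term 0 → Budgeted) → Term 0 → Budgeted
Eval P t k = ∃[ v ] ∃[ i ] ∃[ j ] (t ⇓⟨ i ⟩ v × i + j ≤ k × P v j)

Eval-map : ∀ {P Q} → (∀ {v} → P v ⊆ Q v) → ∀ {t} → Eval P t ⊆ Eval Q t
Eval-map f (v , i , j , t⇓ , le , p) = v , i , j , t⇓ , le , f p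

Eval-mono : ∀ {P t k k′} → k ≤ k′ → Eval P t k → Eval P t k′
Eval-mono le (v , i , j , t⇓ , le′ , p) = v , i , j , t⇓ , ≤-trans le′ le , p

-- Realizers

mutual
  -- The arrow clause is a separating implication: the body may spend the function's budget plus the
  -- argument's. The β-step itself is charged to the application.
  V : Linear → Term 0 → Budgeted
  V 𝗇       v k = Value v
  V (M ⊸ L) v k = ∃[ b ] (v ≡ ƛ b × (∀ w j → Value w → V* M w j → Eval (V L) (b ⟦ w ⟧) (k + j)))

  V* : Multi → Term 0 → Budgeted
  V* []      v k = ⊤
  V* (L ∷ M) v   = V L v ✶ V* M v

mutual
  -- Arrow domains are contravariant, so each direction calls the other. Proving both at once keeps
  -- the recursion structural, which inverting the equality would not.
  V-to : ∀ {L L′ v} → L ≈ L′ → V L v ⊆ V L′ v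
  V-to 𝗇       r = r
  V-to (p ⊸ q) (b , eq , f) = b , eq , λ w j val r → Eval-map (V-to q) (f w j val (V*-from p r))

  V-from : ∀ {L L′ v} → L ≈ L′ → V L′ v ⊆ V L v
  V-from 𝗇       r = r
  V-from (p ⊸ q) (b , eq , f) = b , eq , λ w j val r → Eval-map (V-from q) (f w j val (V*-to p r))

  V*-to : ∀ {M M′ v} → M ≈ᴹ M′ → V* M v ⊆ V* M′ v
  V*-to (refl ps)    = V*-toᴾ ps
  V*-to (prep p ps)  = ✶-map (V-to p) (V*-to ps)
  V*-to (swap p q ps) r = ✶-swap (✶-map (V-to p) (✶-map (V-to q) (V*-to ps)) r)
  V*-to (trans ps qs) r = V*-to qs (V*-to ps r)

  V*-from : ∀ {M M′ v} → M ≈ᴹ M′ → V* M′ v ⊆ V* M v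
  V*-from (refl ps)    = V*-fromᴾ ps
  V*-from (prep p ps)  = ✶-map (V-from p) (V*-from ps)
  V*-from (swap p q ps) r = ✶-swap (✶-map (V-from q) (✶-map (V-from p) (V*-from ps)) r)
  V*-from (trans ps qs) r = V*-from ps (V*-from qs r)

  V*-toᴾ : ∀ {M M′ v} → Listwise.Pointwise _≈_ M M′ → V* M v ⊆ V* M′ v
  V*-toᴾ []       r = r
  V*-toᴾ (p ∷ ps) = ✶-map (V-to p) (V*-toᴾ ps)

  V*-fromᴾ : ∀ {M M′ v} → Listwise.Pointwise _≈_ M M′ → V* M′ v ⊆ V* M v
  V*-fromᴾ []       r = r
  V*-fromᴾ (p ∷ ps) = ✶-map (V-from p) (V*-fromᴾ ps)

V*-++ : ∀ M {N v} → V* (M ++ N) v ⊆ V* M v ✶ V* N v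
V*-++ []      r = 0 , _ , ≤-refl , tt , r
V*-++ (L ∷ M) r = ✶-assoc (✶-map id (V*-++ M) r)

-- Environments realizing type contexts

Env : ∀ {n} → TypeContext n → (Fin n → Term 0) → Budgeted
Env []      σ k = ⊤
Env (M ∷ Γ) σ   = V* M (σ zero) ✶ Env Γ (σ ∘ suc)

Env-from : ∀ {n} {Γ Γ′ : TypeContext n} {σ} → Γ ≈ᶜ Γ′ → Env Γ′ σ ⊆ Env Γ σ
Env-from []       r = r
Env-from (p ∷ ps) = ✶-map (V*-from p) (Env-from ps)

Env-⊎ : ∀ {n} (Γ Δ : TypeContext n) {σ} → Env (Γ ⊎ Δ) σ ⊆ Env Γ σ ✶ Env Δ σ
Env-⊎ []      []      _ = 0 , 0 , z≤n , tt , tt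
Env-⊎ (M ∷ Γ) (N ∷ Δ) r = ✶-interchange (✶-map (V*-++ M) (Env-⊎ Γ Δ) r)

Env-lookup : ∀ {n} (x : Fin n) {L σ k} → Env (∅ [ x ]≔ [ L ]) σ k → ∃[ j ] (j ≤ k × V L (σ x) j)
Env-lookup zero (_ , _ , le , (j , _ , le′ , r , _) , _) = j , ≤-trans (m+n≤o⇒m≤o _ le′) (m+n≤o⇒m≤o _ le) , r
Env-lookup (suc x) (i , _ , le , _ , r) with Env-lookup x r
... | j , le′ , r′ = j , ≤-trans le′ (m+n≤o⇒n≤o i le) , r′

-- Evaluation at multi types and of applications

≈ᴹ-[] : ∀ {M M′} → M ≈ᴹ M′ → M ≡ [] → M′ ≡ []
≈ᴹ-[] (refl [])     refl = refl
≈ᴹ-[] (trans ps qs) eq   = ≈ᴹ-[] qs (≈ᴹ-[] ps eq)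

-- A term need not evaluate to have the empty multi type, hence the alternative.
Evalᴹ : Multi → Term 0 → Budgeted
Evalᴹ M t k = M ≡ [] or Eval (V* M) t k

-- By determinism both evaluations reach the same value. The cost `c` of the first is kept, `c′` is
-- dropped, and the remainders `a` and `a′` are added.
Eval-∷ : ∀ {L M t i j} → Eval (V L) t i → Evalᴹ M t j → Eval (V* (L ∷ M)) t (i + j)
Eval-∷ {i = i} {j} (v , c , a , t⇓ , le , r) (inj₁ refl) =
  v , c , a , t⇓ , ≤-trans le (m≤m+n i j)
  , a , 0 , ≤-reflexive (+-identityʳ a) , r , tt
Eval-∷ {i = i} {j} (v , c , a , t⇓ , le , r) (inj₂ (_ , c′ , a′ , t⇓′ , le′ , r′))
  with refl ← ⇓-deterministic t⇓ t⇓′ = v , c , a + a′ , t⇓ , bound , a , a′ , ≤-refl , r , r′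
  where
  open ≤-Reasoning
  bound : c + (a + a′) ≤ i + j
  bound = begin
    c + (a + a′)    ≡⟨ sym (+-assoc c a a′) ⟩
    (c + a) + a′    ≤⟨ +-mono-≤ le (≤-trans (m≤n+m a′ c′) le′) ⟩
    i + j           ∎

-- Premises enter as semantic functions, so this induction on their number stays apart from the one
-- on derivations.
Evalᴹ-many : ∀ {n k t} {σ : Fin n → Term 0} {Γ : Vector (TypeContext n) k} {m : Vector ℕ k} {L : Vector Linear k} →
             (∀ i {s} → Env (Γ i) σ s → Eval (V (L i)) t (m i + s)) →
             ∀ {s} → Env (⨄ Γ) σ s → Evalᴹ (toList L) t (sum m + s)
Evalᴹ-many {k = zero}  f r = inj₁ refl
Evalᴹ-many {k = suc k} {Γ = Γ} {m} {L} f r with Env-⊎ (Γ zero) (⨄ (tail Γ)) r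
... | s₁ , s₂ , le , r₁ , r₂ = inj₂ (Eval-mono
  (≤-trans (≤-reflexive (eq (m zero) s₁ (sum (tail m)) s₂)) (+-monoʳ-≤ (m zero + sum (tail m)) le))
  (Eval-∷ (f zero r₁) (Evalᴹ-many {Γ = tail Γ} {tail m} {tail L} (f ∘ suc) r₂)))
  where
  eq : ∀ a b c d → (a + b) + (c + d) ≡ (a + c) + (b + d)
  eq = solve-∀

-- The final `1` pays for the β-step; the remainders `a₁` of the function and `a₃` of the argument
-- pay for the body.
Eval-app : ∀ {M L t u i j} → Eval (V (M ⊸ L)) t i → Eval (V* (M ++ [ 𝗇 ])) u j →
           Eval (V L) (t · u) (i + j + 1)
Eval-app {M} {i = i} {j} (_ , c₁ , a₁ , t⇓ , le₁ , b , refl , f) (v , c₂ , a₂ , u⇓ , le₂ , r)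
  -- The share of the trailing `𝗇` is discarded once the argument is evaluated.
  with V*-++ M r
... | a₃ , _ , le₃ , r′ , _ with f v a₃ (⇓-value u⇓) r′
... | w , c₄ , a₄ , b⇓ , le₄ , r″ = w , c₁ + (c₂ + suc c₄) , a₄ , app t⇓ u⇓ b⇓ , bound , r″
  where
  open ≤-Reasoning
  eq₁ : ∀ c₁ c₂ c₄ a₄ → c₁ + (c₂ + (1 + c₄)) + a₄ ≡ c₁ + c₂ + 1 + (c₄ + a₄)
  eq₁ = solve-∀
  eq₂ : ∀ c₁ c₂ a₁ a₃ → c₁ + c₂ + 1 + (a₁ + a₃) ≡ (c₁ + a₁) + (c₂ + a₃) + 1
  eq₂ = solve-∀
  bound : c₁ + (c₂ + suc c₄) + a₄ ≤ i + j + 1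
  bound = begin
    c₁ + (c₂ + suc c₄) + a₄      ≡⟨ eq₁ c₁ c₂ c₄ a₄ ⟩
    c₁ + c₂ + 1 + (c₄ + a₄)      ≤⟨ +-monoʳ-≤ (c₁ + c₂ + 1) le₄ ⟩
    c₁ + c₂ + 1 + (a₁ + a₃)      ≡⟨ eq₂ c₁ c₂ a₁ a₃ ⟩
    (c₁ + a₁) + (c₂ + a₃) + 1    ≤⟨ +-mono-≤ (+-mono-≤ le₁ (≤-trans (+-monoʳ-≤ c₂ (m+n≤o⇒m≤o a₃ le₃)) le₂)) ≤-refl ⟩
    i + j + 1                    ∎

∷ᶠ-value : ∀ {n w} {σ : Fin n → Term 0} → Value w → (∀ x → Value (σ x)) → ∀ x → Value ((w ∷ᶠ σ) x)
∷ᶠ-value val vals zero    = val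
∷ᶠ-value val vals (suc x) = vals x

-- Adequacy of the realizers

mutual
  -- Open terms are closed by values so that the induction passes under `lam`; `s` is the budget the
  -- environment brings on top of `m`.
  adequacy : ∀ {n m e t L} {Γ : TypeContext n} {σ : Fin n → Term 0} →
             Γ ⊢⟨ m , e ⟩ t ∶ L → (∀ x → Value (σ x)) →
             ∀ {s} → Env Γ σ s → Eval (V L) (subst σ t) (m + s)
  adequacy {σ = σ} (ax {x}) vals r with Env-lookup x r
  ... | j , le , r′ = σ x , 0 , j , value-⇓ (vals x) , le , r′
  adequacy axƛ vals r = _ , 0 , 0 , ƛ , z≤n , ƛ _
  adequacy {σ = σ} (lam {m = m} {t = t} D) vals {s} r =
    -- An abstraction evaluates in zero steps, so all of `m + s` is saved for its body; the
    -- argument's `j` joins the environment.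
    _ , 0 , m + s , ƛ , ≤-refl , _ , refl , λ w j val r′ →
      transport (λ b → Eval _ b (m + s + j)) (sym (subst-extˢ-⟦⟧ σ w t))
        (Eval-mono (≤-reflexive (eq m s j))
          (adequacy D (∷ᶠ-value val vals) (j , s , ≤-refl , r′ , r)))
    where
    eq : ∀ m s j → m + (j + s) ≡ m + s + j
    eq = solve-∀
  adequacy (app {Γ} {Δ} {M} {m} {m′ = m′} D E) vals r with Env-⊎ Γ Δ r
  ... | s₁ , s₂ , le , r₁ , r₂ with adequacyᴹ E vals r₂
  -- Here `𝗇` forces the argument to evaluate, even when `M` is empty.
  ... | inj₁ eq with () ← ++-conicalʳ M [ 𝗇 ] eq
  ... | inj₂ ev = Eval-mono
    (≤-trans (≤-reflexive (eq m s₁ m′ s₂)) (+-monoʳ-≤ (m + m′ + 1) le))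
    (Eval-app {M} (adequacy D vals r₁) ev)
    where
    eq : ∀ m s₁ m′ s₂ → (m + s₁) + (m′ + s₂) + 1 ≡ m + m′ + 1 + (s₁ + s₂)
    eq = solve-∀
  adequacy (conv p q D) vals r = Eval-map (V-to q) (adequacy D vals (Env-from p r))

  adequacyᴹ : ∀ {n m e t M} {Γ : TypeContext n} {σ : Fin n → Term 0} →
              Γ ⊢⟨ m , e ⟩ t ∶ᴹ M → (∀ x → Value (σ x)) →
              ∀ {s} → Env Γ σ s → Evalᴹ M (subst σ t) (m + s)
  adequacyᴹ (many {Γ = Γ} {m} {L = L} D) vals r =
    Evalᴹ-many {Γ = Γ} {m} {L} (λ i → adequacy (D i) vals) r
  adequacyᴹ (convᴹ p q D) vals r with adequacyᴹ D vals (Env-from p r)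
  ... | inj₁ eq = inj₁ (≈ᴹ-[] q eq)
  ... | inj₂ ev = inj₂ (Eval-map (V*-to q) ev)

theorem7p2 : (t : Term 0) (L : Linear) (m e : ℕ) →
    ∅ ⊢⟨ m , e ⟩ t ∶ L →
    ∃[ v ] (Value v × (Σ[ d ∈ t →βv* v ] ∣ d ∣ ≤ m))
-- A closed term takes the vacuous substitution `var` and an environment of budget 0.
theorem7p2 t L m e D with adequacy {σ = var} D (λ ()) {0} tt
... | v , i , j , t⇓ , le , _ with ⇓⇒→βv⟨⟩ t⇓
... | d , refl = v , ⇓-value t⇓ ,
  transport (λ u → Σ[ d ∈ u →βv* v ] ∣ d ∣ ≤ m) (subst-id (λ _ → refl) t)
    (d , ≤-trans (m+n≤o⇒m≤o _ le) (≤-reflexive (+-identityʳ m)))
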